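{- Let $r\ge 1$ and let $m_1,\dots,m_r$ be integers with $m_i\ge 2$ for every $1\le i\le r$. Then for every integer $k\ge 1$, $$ch_k(K_{m_1,\ldots,m_r})\le 948\, r\Big(k+\log\frac{m_1+\cdots+m_r}{r}\Big),$$ where $\log$ denotes the natural logarithm.
   Context: $K_{m_1,\ldots,m_r}$ denotes the complete $r$-partite graph whose $i$-th vertex class has $m_i$ vertices. A graph $G=(V,E)$ is $(a:b)$-choosable if for every family of sets $\{S(v):v\in V\}$ with $|S(v)|=a$ for all $v$, there exist subsets $C(v)\subseteq S(v)$ with $|C(v)|=b$ for every $v$ and $C(u)\cap C(v)=\emptyset$ whenever $u,v$ are adjacent. $ch_k(G)$ is the smallest integer $n$ such that $G$ is $(n:k)$-choosable. -}

module Defs where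

open import Data.Nat using (ℕ; zero; suc; _+_; _*_; _∸_; _^_; _≤_; _<_; _!)
open import Data.Fin using (Fin)
open import Data.List using (map; allFin)
open import Data.Nat.ListAction using (sum)
open import Data.Product using (Σ; ∃; _×_; _,_)
open import Function.Definitions using (Injective)
open import Relation.Binary.PropositionalEquality using (_≡_; _≢_)
open import Relation.Nullary using (¬_)

-- (a:b)-choosability of a graph with vertex set V and adjacency relation Adj.
-- Colours are natural numbers; a list S(v) of size a is an injective map Fin a → ℕ,
-- a subset C(v) ⊆ S(v) of size b is an injective map Fin b → Fin a (its image in S(v)).
Choosable : (V : Set) (Adj : V → V → Set) (a b : ℕ) → Set
Choosable V Adj a b =
  (S : V → Fin a → ℕ) → (∀ v → Injective _≡_ _≡_ (S v)) →
  Σ ((v : V) → Fin b → Fin a) λ C →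
    (∀ v → Injective _≡_ _≡_ (C v)) ×
    (∀ u v → Adj u v → ∀ x y → S u (C u x) ≢ S v (C v y))

KVertex : (r : ℕ) → (Fin r → ℕ) → Set
KVertex r m = Σ (Fin r) (λ i → Fin (m i))

KAdj : (r : ℕ) (m : Fin r → ℕ) → KVertex r m → KVertex r m → Set
KAdj r m (i , _) (j , _) = ¬ (i ≡ j)

total : (r : ℕ) → (Fin r → ℕ) → ℕ
total r m = sum (map m (allFin r))

-- expSc j N = Σ_{i=0}^{N} j^i · N!/i!   (so expSc j N / N! is the N-th partial sum of e^j)
expSc : ℕ → ℕ → ℕ
expSc j zero = 1
expSc j (suc N) = suc N * expSc j N + j ^ suc N

-- LeBound r k M n  encodes the real inequality  n ≤ 948 r (k + ln (M / r))  (r ≥ 1, M ≥ 1).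
-- With R = 948 r and c = R k this is  n - c ≤ R ln(M/r), i.e.
--   if n ≥ c :  r^R · e^(n-c) ≤ M^R   ⇔  ∀ N, r^R · expSc (n-c) N ≤ M^R · N!
--   if n < c :  r^R ≤ M^R · e^(c-n)   ⇔  ∃ N, r^R · N! ≤ M^R · expSc (c-n) N
-- (the latter using that e^(c-n) is irrational for c-n > 0, so the inequality is strict).
LeBound : (r k M n : ℕ) → Set
LeBound r k M n =
  (c ≤ n → ∀ N → r ^ R * expSc (n ∸ c) N ≤ M ^ R * (N !)) ×
  (n < c → ∃ λ N → r ^ R * (N !) ≤ M ^ R * expSc (c ∸ n) N)
  where
  R = 948 * r
  c = R * k

-- ch_k(G) ≤ 948 r (k + ln((m_1+...+m_r)/r)) : some n below the bound has G (n:k)-choosable.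
ChkLeBound : (r : ℕ) (m : Fin r → ℕ) (k : ℕ) → Set
ChkLeBound r m k =
  ∃ λ n → LeBound r k (total r m) n × Choosable (KVertex r m) (KAdj r m) n k

{-# OPTIONS --safe #-}

-- Say that s slots and at most 2^K s vertices are to be served, each vertex with 48sK colours. Every
-- colour independently goes to the reserve with probability 1/2 and otherwise to a uniformly random
-- slot. The exponential moments E[2^-X] show that every vertex keeps a quarter of its list in the reserve,
-- while at most s/8 vertices receive fewer than k colours. Those few vertices are served from the
-- reserve by induction, each in a slot of its own: the lists have shrunk by a factor 4 but the number
-- of slots by a factor 8. With 2^ℓ ≤ M/r < 2^(ℓ+1) and K = k + ℓ,
-- the bound 48rK ≤ 948r(k + log(M/r)) follows from e ≤ 4.
module Submission where

open import Defs
open import Data.Bool using (Bool; T; true; false; if_then_else_; _∧_; not)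
open import Data.Empty using (⊥)
open import Data.Fin using (Fin; zero; suc; _≟_; _↑ˡ_; _↑ʳ_; splitAt; toℕ; fromℕ<; inject≤)
import Data.Fin.Properties as Fin
open import Data.List.Properties using (map-tabulate)
import Data.Nat.ListAction as List
open import Data.Nat using (ℕ; zero; suc; pred; _+_; _*_; _∸_; _^_; _!; _≤_; _<_; z≤n; s≤s; _<ᵇ_; _≤?_; NonZero; >-nonZero; >-nonZero⁻¹)
open import Data.Nat.Properties as ℕ hiding (_≟_)
open import Data.Nat.Induction using (<-wellFounded)
open import Data.Nat.Tactic.RingSolver using (solve-∀)
open import Data.Product using (∃; _×_; _,_; proj₁; proj₂)
open import Data.Sum using (_⊎_; inj₁; inj₂)
open import Data.Vec.Functional using (_∷_)
open import Function using (_∘_)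
open import Induction.WellFounded using (Acc; acc)
open import Function.Definitions using (Injective)
open import Relation.Binary.PropositionalEquality using (_≡_; _≢_; refl; sym; trans; cong; cong₂; subst)
open import Relation.Nullary.Decidable using (dec-true)
open import Relation.Nullary using (Dec; does; yes; no; contradiction)

open import Algebra.Properties.Semiring.Sum +-*-semiring
  using (sum; sum-cong-≗; ∑-comm; ∑-distrib-+; *-distribˡ-sum)
open import Algebra.Properties.CommutativeMonoid.Sum *-1-commutativeMonoid
  using () renaming (sum to product; sum-cong-≗ to product-cong-≗)

open ≤-Reasoning

-- Finite sums and averages

sum-const : ∀ n c → sum {n} (λ _ → c) ≡ n * c
sum-const zero    c = refl
sum-const (suc n) c = cong (c +_) (sum-const n c)

sum-mono-≤ : ∀ {n} {f g : Fin n → ℕ} → (∀ i → f i ≤ g i) → sum f ≤ sum g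
sum-mono-≤ {zero}  f≤g = z≤n
sum-mono-≤ {suc n} f≤g = +-mono-≤ (f≤g zero) (sum-mono-≤ (f≤g ∘ suc))

term≤sum : ∀ {n} (f : Fin n → ℕ) i → f i ≤ sum f
term≤sum f zero    = m≤m+n _ _
term≤sum f (suc i) = ≤-trans (term≤sum (f ∘ suc) i) (m≤n+m _ _)

sum-average : ∀ {n} .{{_ : NonZero n}} (f : Fin n → ℕ) → ∃ λ i → n * f i ≤ sum f
sum-average {suc zero}    f = zero , ≤-refl
sum-average {suc (suc n)} f with sum-average (f ∘ suc)
... | i , le with ≤-total (f zero) (f (suc i))
...   | inj₁ f₀≤fᵢ = zero , +-monoʳ-≤ (f zero) (≤-trans (*-monoʳ-≤ (suc n) f₀≤fᵢ) le)
...   | inj₂ fᵢ≤f₀ = suc i , +-mono-≤ fᵢ≤f₀ le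

-- Two index sets of the argument have this shape: the outcomes of one colour (a slot and a flag),
-- and the random variables to be controlled (a vertex, with `true` for its slot and `false` for the
-- reserve).
∑₂ : ∀ {n} → (Fin n × Bool → ℕ) → ℕ
∑₂ f = sum (λ i → f (i , true)) + sum (λ i → f (i , false))

∑₂-cong : ∀ {n} {f g : Fin n × Bool → ℕ} → (∀ x → f x ≡ g x) → ∑₂ f ≡ ∑₂ g
∑₂-cong f≗g = cong₂ _+_ (sum-cong-≗ (λ i → f≗g (i , true))) (sum-cong-≗ (λ i → f≗g (i , false)))

∑₂-mono-≤ : ∀ {n} {f g : Fin n × Bool → ℕ} → (∀ x → f x ≤ g x) → ∑₂ f ≤ ∑₂ g
∑₂-mono-≤ f≤g = +-mono-≤ (sum-mono-≤ (λ i → f≤g (i , true))) (sum-mono-≤ (λ i → f≤g (i , false)))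

*-distribˡ-∑₂ : ∀ {n} c (f : Fin n × Bool → ℕ) → c * ∑₂ f ≡ ∑₂ (λ x → c * f x)
*-distribˡ-∑₂ c f = trans (*-distribˡ-+ c _ _)
  (cong₂ _+_ (*-distribˡ-sum c (λ i → f (i , true))) (*-distribˡ-sum c (λ i → f (i , false))))

∑₂-comm : ∀ {m n} (f : Fin m × Bool → Fin n × Bool → ℕ) →
          ∑₂ (λ x → ∑₂ (f x)) ≡ ∑₂ (λ y → ∑₂ (λ x → f x y))
∑₂-comm {m} {n} f = begin-equality
  sum (λ i → row true true i + row true false i) + sum (λ i → row false true i + row false false i)
    ≡⟨ cong₂ _+_ (∑-distrib-+ (row true true) _) (∑-distrib-+ (row false true) _) ⟩
  (sum (row true true) + sum (row true false)) + (sum (row false true) + sum (row false false))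
    ≡⟨ cong₂ _+_ (cong₂ _+_ (swap true true) (swap true false)) (cong₂ _+_ (swap false true) (swap false false)) ⟩
  (sum (col true true) + sum (col true false)) + (sum (col false true) + sum (col false false))
    ≡⟨ interchange (sum (col true true)) (sum (col true false)) (sum (col false true)) (sum (col false false)) ⟩
  (sum (col true true) + sum (col false true)) + (sum (col true false) + sum (col false false))
    ≡⟨ cong₂ _+_ (∑-distrib-+ (col true true) _) (∑-distrib-+ (col true false) _) ⟨
  ∑₂ (λ y → ∑₂ (λ x → f x y)) ∎
  where
  row : Bool → Bool → Fin m → ℕ
  row a b i = sum (λ j → f (i , a) (j , b))
  col : Bool → Bool → Fin n → ℕ
  col a b j = sum (λ i → f (i , a) (j , b))
  swap : ∀ a b → sum (row a b) ≡ sum (col a b)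
  swap a b = ∑-comm (λ i j → f (i , a) (j , b))
  interchange : ∀ w x y z → (w + x) + (y + z) ≡ (w + y) + (x + z)
  interchange = solve-∀

∑₂-average : ∀ {n} .{{_ : NonZero n}} (f : Fin n × Bool → ℕ) → ∃ λ x → (n + n) * f x ≤ ∑₂ f
∑₂-average {n} f with sum-average (λ i → f (i , true)) | sum-average (λ i → f (i , false))
... | i , leᵢ | j , leⱼ with ≤-total (f (i , true)) (f (j , false))
...   | inj₁ fᵢ≤fⱼ = (i , true) , ≤-trans (≤-reflexive (*-distribʳ-+ _ n n))
                       (+-mono-≤ leᵢ (≤-trans (*-monoʳ-≤ n fᵢ≤fⱼ) leⱼ))
...   | inj₂ fⱼ≤fᵢ = (j , false) , ≤-trans (≤-reflexive (*-distribʳ-+ _ n n))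
                       (+-mono-≤ (≤-trans (*-monoʳ-≤ n fⱼ≤fᵢ) leᵢ) leⱼ)

-- Method of conditional expectations: each factor is fixed in turn to an outcome that does not
-- increase the expectation.
exists-below-average :
  ∀ {p s N} .{{_ : NonZero s}} (a : Fin p × Bool → ℕ) (φ : Fin p × Bool → Fin N → Fin s × Bool → ℕ) →
  ∃ λ (g : Fin N → Fin s × Bool) →
    (s + s) ^ N * ∑₂ (λ j → a j * product (λ x → φ j x (g x))) ≤ ∑₂ (λ j → a j * product (λ x → ∑₂ (φ j x)))
exists-below-average {N = zero}  a φ = (λ ()) , ≤-reflexive (*-identityˡ _)
exists-below-average {p} {s} {suc N} a φ = c ∷ g , (begin
  (s + s) * (s + s) ^ N * ∑₂ (λ j → a j * (φ j zero c * P j))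
    ≡⟨ *-assoc (s + s) _ _ ⟩
  (s + s) * ((s + s) ^ N * ∑₂ (λ j → a j * (φ j zero c * P j)))
    ≡⟨ cong (λ t → (s + s) * ((s + s) ^ N * t)) (∑₂-cong (λ j → *-assoc (a j) (φ j zero c) (P j))) ⟨
  (s + s) * ((s + s) ^ N * ∑₂ (λ j → a j * φ j zero c * P j))
    ≤⟨ *-monoʳ-≤ (s + s) (proj₂ rest) ⟩
  (s + s) * F c
    ≤⟨ proj₂ first ⟩
  ∑₂ F
    ≡⟨ ∑₂-comm (λ c j → a j * φ j zero c * R j) ⟩
  ∑₂ (λ j → ∑₂ (λ c → a j * φ j zero c * R j))
    ≡⟨ ∑₂-cong (λ j → trans (∑₂-cong (λ c → rotate (a j) (φ j zero c) (R j)))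
                            (trans (sym (*-distribˡ-∑₂ (a j * R j) (φ j zero)))
                                   (sym (rotate (a j) (∑₂ (φ j zero)) (R j))))) ⟩
  ∑₂ (λ j → a j * ∑₂ (φ j zero) * R j)
    ≡⟨ ∑₂-cong (λ j → *-assoc (a j) (∑₂ (φ j zero)) (R j)) ⟩
  ∑₂ (λ j → a j * (∑₂ (φ j zero) * R j)) ∎)
  where
  R : Fin p × Bool → ℕ
  R j = product (λ x → ∑₂ (φ j (suc x)))
  F : Fin s × Bool → ℕ
  F c = ∑₂ (λ j → a j * φ j zero c * R j)
  first = ∑₂-average F
  c = proj₁ first
  -- The factor just fixed is absorbed into the coefficient; this is why the statement allows an
  -- arbitrary `a`.
  rest = exists-below-average (λ j → a j * φ j zero c) (λ j → φ j ∘ suc)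
  g = proj₁ rest
  P : Fin p × Bool → ℕ
  P j = product (λ x → φ j (suc x) (g x))
  rotate : ∀ x y z → x * y * z ≡ x * z * y
  rotate = solve-∀

-- Counting and enumerating decidable subsets

count : ∀ {n} → (Fin n → Bool) → ℕ
count P = sum (λ i → if P i then 1 else 0)

-- A bijection between `Fin c` and the positions where `P` holds. It renumbers the bad vertices for
-- the recursive call, and later lists the colours chosen for a vertex.
record Enumeration {n} (P : Fin n → Bool) (c : ℕ) : Set where
  field
    element   : Fin c → Fin n
    index     : ∀ x → P x ≡ true → Fin c
    satisfies : ∀ i → P (element i) ≡ true
    element-index     : ∀ x Px → element (index x Px) ≡ x
    element-injective : ∀ {i j} → element i ≡ element j → i ≡ j

enumerate : ∀ {n} (P : Fin n → Bool) → Enumeration P (count P)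
enumerate {zero} P = record
  { element   = λ ()
  ; index     = λ ()
  ; satisfies = λ ()
  ; element-index     = λ ()
  ; element-injective = λ { {()} }
  }
enumerate {suc n} P with P zero in P₀ | enumerate (P ∘ suc)
... | true  | E = record
  { element   = element′
  ; index     = index′
  ; satisfies = λ { zero → P₀ ; (suc i) → satisfies i }
  ; element-index = λ { zero _ → refl ; (suc x) Px → cong suc (element-index x Px) }
  ; element-injective = injective′ _ _
  }
  where
  open Enumeration E
  element′ : Fin (suc (count (P ∘ suc))) → Fin (suc n)
  element′ zero    = zero
  element′ (suc i) = suc (element i)
  index′ : ∀ x → P x ≡ true → Fin (suc (count (P ∘ suc)))
  index′ zero    _  = zero
  index′ (suc x) Px = suc (index x Px)
  injective′ : ∀ i j → element′ i ≡ element′ j → i ≡ j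
  injective′ zero    zero    _  = refl
  injective′ (suc i) (suc j) eq = cong suc (element-injective (Fin.suc-injective eq))
... | false | E = record
  { element   = suc ∘ element
  ; index     = index′
  ; satisfies = satisfies
  ; element-index = λ { zero P0 → contradiction (trans (sym P₀) P0) (λ ()) ; (suc x) Px → cong suc (element-index x Px) }
  ; element-injective = λ eq → element-injective (Fin.suc-injective eq)
  }
  where
  open Enumeration E
  index′ : ∀ x → P x ≡ true → Fin (count (P ∘ suc))
  index′ zero    P0 = contradiction (trans (sym P₀) P0) (λ ())
  index′ (suc x) Px = index x Px

injection⇒≤count : ∀ {m n} (P : Fin n → Bool) (f : Fin m → Fin n) → Injective _≡_ _≡_ f →
                   (∀ i → P (f i) ≡ true) → m ≤ count P
injection⇒≤count P f f-injective Pf = Fin.injective⇒≤ {f = λ i → index (f i) (Pf i)} λ {i} {j} eq →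
  f-injective (trans (sym (element-index _ (Pf i))) (trans (cong element eq) (element-index _ (Pf j))))
  where open Enumeration (enumerate P)

count≡0⇒false : ∀ {n} (P : Fin n → Bool) → count P ≡ 0 → ∀ i → P i ≡ false
count≡0⇒false P none i with P i in Pᵢ
... | false = refl
... | true  = contradiction (subst Fin none (index i Pᵢ)) Fin.¬Fin0
  where open Enumeration (enumerate P)

-- Two-valued products and power inequalities

*-left-comm : ∀ x y z → x * (y * z) ≡ y * (x * z)
*-left-comm = solve-∀

-- The product is a^c b^(n-c) for c = `count P`; the factor b^c on the left avoids a subtraction in
-- the exponent.
product-if : ∀ {n} (P : Fin n → Bool) a b →
             b ^ count P * product (λ i → if P i then a else b) ≡ a ^ count P * b ^ n
product-if {zero}  P a b = refl
product-if {suc n} P a b with P zero | product-if (P ∘ suc) a b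
... | true  | eq = trans (pull b (b ^ c) a Π) (trans (cong (b * a *_) eq) (push b a (a ^ c) (b ^ n)))
  where
  c = count (P ∘ suc)
  Π = product (λ i → if P (suc i) then a else b)
  pull : ∀ b B a Π → b * B * (a * Π) ≡ b * a * (B * Π)
  pull = solve-∀
  push : ∀ b a A B → b * a * (A * B) ≡ a * A * (b * B)
  push = solve-∀
... | false | eq = trans (*-left-comm (b ^ c) b Π) (trans (cong (b *_) eq) (*-left-comm b (a ^ c) (b ^ n)))
  where
  c = count (P ∘ suc)
  Π = product (λ i → if P (suc i) then a else b)

ratio-mono : ∀ {a b c m n} → a ≤ b → c * a ^ m ≤ b ^ m → m ≤ n → c * a ^ n ≤ b ^ n
ratio-mono {a} {b} {c} {m} {n} a≤b le m≤n =
  subst (λ n → c * a ^ n ≤ b ^ n) (m+[n∸m]≡n m≤n) (begin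
    c * a ^ (m + d)     ≡⟨ cong (c *_) (^-distribˡ-+-* a m d) ⟩
    c * (a ^ m * a ^ d) ≡⟨ *-assoc c _ _ ⟨
    c * a ^ m * a ^ d   ≤⟨ *-mono-≤ le (^-monoˡ-≤ d a≤b) ⟩
    b ^ m * b ^ d       ≡⟨ ^-distribˡ-+-* b m d ⟨
    b ^ (m + d)         ∎)
  where d = n ∸ m

-- The form in which exponential moments are bounded: each listed colour contributes a factor a/b to
-- the mean, there are at least `n` of them, and (a/b)^n ≤ 1/c.
product-if-≤ : ∀ {N} (P : Fin N → Bool) {a b c n} .{{_ : NonZero b}} → a ≤ b → c * a ^ n ≤ b ^ n →
               n ≤ count P → c * product (λ i → if P i then a else b) ≤ b ^ N
product-if-≤ {N} P {a} {b} {c} a≤b le n≤#P = *-cancelˡ-≤ (b ^ count P) {{m^n≢0 b (count P)}} (begin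
  b ^ count P * (c * Π)         ≡⟨ *-left-comm (b ^ count P) c Π ⟩
  c * (b ^ count P * Π)         ≡⟨ cong (c *_) (product-if P a b) ⟩
  c * (a ^ count P * b ^ N)     ≡⟨ *-assoc c _ _ ⟨
  c * a ^ count P * b ^ N       ≤⟨ *-monoˡ-≤ (b ^ N) (ratio-mono {c = c} a≤b le n≤#P) ⟩
  b ^ count P * b ^ N           ∎)
  where
  Π = product (λ i → if P i then a else b)

^-distribʳ-* : ∀ n a b → (a * b) ^ n ≡ a ^ n * b ^ n
^-distribʳ-* zero    a b = refl
^-distribʳ-* (suc n) a b = trans (cong (a * b *_) (^-distribʳ-* n a b)) (interchange a b _ _)
  where
  interchange : ∀ a b A B → a * b * (A * B) ≡ a * A * (b * B)
  interchange = solve-∀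

ratio-power : ∀ {c a b} m e → c * a ^ m ≤ b ^ m → c ^ e * a ^ (m * e) ≤ b ^ (m * e)
ratio-power {c} {a} {b} m e le = begin
  c ^ e * a ^ (m * e)   ≡⟨ cong (c ^ e *_) (^-*-assoc a m e) ⟨
  c ^ e * (a ^ m) ^ e   ≡⟨ ^-distribʳ-* e c (a ^ m) ⟨
  (c * a ^ m) ^ e       ≤⟨ ^-monoˡ-≤ e le ⟩
  (b ^ m) ^ e           ≡⟨ ^-*-assoc b m e ⟩
  b ^ (m * e)           ∎

-- Bernoulli's inequality (1 + 1/d)^m ≥ 1 + m/d with denominators cleared.
bernoulli : ∀ d m → (d + m) * d ^ m ≤ d * suc d ^ m
bernoulli d zero    = ≤-reflexive (cong (_* 1) (+-identityʳ d))
bernoulli d (suc m) = begin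
  (d + suc m) * (d * d ^ m)                 ≤⟨ m≤m+n _ (m * d ^ m) ⟩
  (d + suc m) * (d * d ^ m) + m * d ^ m     ≡⟨ regroup d m (d ^ m) ⟩
  suc d * ((d + m) * d ^ m)                 ≤⟨ *-monoʳ-≤ (suc d) (bernoulli d m) ⟩
  suc d * (d * suc d ^ m)                   ≡⟨ *-left-comm (suc d) d _ ⟩
  d * (suc d * suc d ^ m)                   ∎
  where
  regroup : ∀ d m x → (d + suc m) * (d * x) + m * x ≡ suc d * ((d + m) * x)
  regroup = solve-∀

-- Bernoulli with m = d + 1 gives (1 + 1/d)^(d+1) ≥ 2 + 1/d. The case d = 0 is separate because d
-- gets cancelled. With d + 1 = 4s this reads (1 - 1/(4s))^(4s) ≤ 1/2.
2*d^[1+d]≤[1+d]^[1+d] : ∀ d → 2 * d ^ suc d ≤ suc d ^ suc d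
2*d^[1+d]≤[1+d]^[1+d] zero       = z≤n
2*d^[1+d]≤[1+d]^[1+d] d@(suc _) = *-cancelˡ-≤ d (begin
  d * (2 * d ^ suc d)         ≤⟨ m≤m+n _ (d ^ suc d) ⟩
  d * (2 * d ^ suc d) + d ^ suc d ≡⟨ regroup d (d ^ suc d) ⟩
  (d + suc d) * d ^ suc d     ≤⟨ bernoulli d (suc d) ⟩
  d * suc d ^ suc d           ∎)
  where
  regroup : ∀ d x → d * (2 * x) + x ≡ (d + suc d) * x
  regroup = solve-∀

n≤2^n : ∀ n → n ≤ 2 ^ n
n≤2^n zero    = z≤n
n≤2^n (suc n) = begin
  1 + n               ≤⟨ +-mono-≤ (m^n>0 2 n) (n≤2^n n) ⟩
  2 ^ n + 2 ^ n       ≡⟨ cong (2 ^ n +_) (+-identityʳ (2 ^ n)) ⟨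
  2 ^ suc n           ∎

-- One round of random distribution

sum-if-≟ : ∀ {n} (j : Fin n) → suc (sum (λ i → if does (i ≟ j) then 1 else 2)) ≡ n * 2
sum-if-≟ {suc n} zero    = cong (2 +_) (sum-const n 2)
sum-if-≟ {suc n} (suc j) = cong (2 +_) (sum-if-≟ j)

-- A colour's outcome (i , true) gives it to slot i, and (i , false) puts it into the reserve.
-- hit σ S (v , true) marks the colours of v won by its slot, hit σ S (v , false) those held in reserve.
hit : ∀ {p s N} → (Fin p → Fin s) → (Fin p → Fin N → Bool) → Fin p × Bool → Fin N → Fin s × Bool → Bool
hit σ S (v , true)  x (i , b) = S v x ∧ (b ∧ does (i ≟ σ v))
hit σ S (v , false) x (i , b) = S v x ∧ not b

module _ {p s N} (σ : Fin p → Fin s) (S : Fin p → Fin N → Bool) where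

  -- Weights 1 for a hit and 2 for a miss replace 1/2 and 1, to stay in the integers. Exactly one of
  -- the 2s outcomes hands a listed colour to the slot of `v`, so the total drops from 4s by 1.
  ∑₂-own : ∀ v x → ∑₂ (λ c → if hit σ S (v , true) x c then 1 else 2) ≡ (if S v x then pred (s * 4) else s * 4)
  ∑₂-own v x with S v x
  ... | true  = cong pred (trans (cong₂ _+_ (sum-if-≟ (σ v)) (sum-const s 2)) (sym (*-distribˡ-+ s 2 2)))
  ... | false = trans (cong₂ _+_ (sum-const s 2) (sum-const s 2)) (sym (*-distribˡ-+ s 2 2))

  -- Half of the 2s outcomes send a listed colour to the reserve, so the total is 2s + s.
  ∑₂-spare : ∀ v x → ∑₂ (λ c → if hit σ S (v , false) x c then 1 else 2) ≡ (if S v x then s * 3 else s * 4)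
  ∑₂-spare v x with S v x
  ... | true  = trans (cong₂ _+_ (sum-const s 2) (sum-const s 1)) (sym (*-distribˡ-+ s 2 1))
  ... | false = trans (cong₂ _+_ (sum-const s 2) (sum-const s 2)) (sym (*-distribˡ-+ s 2 2))

<ᵇ-true : ∀ {m n} → (m <ᵇ n) ≡ true → m < n
<ᵇ-true {m} {n} eq = <ᵇ⇒< m n (subst T (sym eq) _)

<ᵇ-false : ∀ {m n} → (m <ᵇ n) ≡ false → n ≤ m
<ᵇ-false eq = ≮⇒≥ λ m<n → subst T eq (<⇒<ᵇ m<n)

module Round {p s N K k} .{{_ : NonZero s}} (1≤K : 1 ≤ K) (k≤K : k ≤ K) (p≤2^K*s : p ≤ 2 ^ K * s)
             (σ : Fin p → Fin s) (S : Fin p → Fin N → Bool) (large : ∀ v → s * K * 48 ≤ count (S v)) where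

  threshold : Bool → ℕ
  threshold true  = k
  threshold false = s * K * 12

  -- The weighted number of deficiencies will be at most s/2. Weight 4 then leaves at most s/8
  -- vertices short in their slots, and weight s leaves none short in the reserve.
  weight : Bool → ℕ
  weight true  = 4
  weight false = s

  coefficient : Fin p × Bool → ℕ
  coefficient (v , b) = weight b * 2 ^ threshold b

  received : (Fin N → Fin s × Bool) → Fin p × Bool → Fin N → Bool
  received g j x = hit σ S j x (g x)

  deficient : (Fin N → Fin s × Bool) → Fin p × Bool → Bool
  deficient g (v , b) = count (received g (v , b)) <ᵇ threshold b

  -- This is (4s)^N E[2^-X], where X counts the colours received; independence of the colours turns
  -- the mean into a product. Likewise `attained` is 2^(N-X) for one assignment.
  expected : Fin p × Bool → ℕ
  expected j = product (λ x → ∑₂ (λ c → if hit σ S j x c then 1 else 2))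

  attained : (Fin N → Fin s × Bool) → Fin p × Bool → ℕ
  attained g j = product (λ x → if received g j x then 1 else 2)

  2^-distrib₄ : ∀ x y → 4 * 2 ^ x * 2 ^ y ≡ 2 ^ (2 + x + y)
  2^-distrib₄ x y = trans (regroup (2 ^ x) (2 ^ y)) (sym (^-distribˡ-+-* 2 (2 + x) y))
    where
    regroup : ∀ a b → 4 * a * b ≡ 2 * (2 * a) * b
    regroup = solve-∀

  -- The moment bound 2^(-12K) has to pay for the coefficient 4 * 2^k and for the factor 4 * 2^K
  -- lost in summing over the vertices.
  own-slack : 4 * 2 ^ K * (4 * 2 ^ k) ≤ 2 ^ (K * 12)
  own-slack = begin
    4 * 2 ^ K * (4 * 2 ^ k)     ≡⟨ cong (4 * 2 ^ K *_) (regroup (2 ^ k)) ⟩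
    4 * 2 ^ K * 2 ^ (2 + k)     ≡⟨ 2^-distrib₄ K (2 + k) ⟩
    2 ^ (2 + K + (2 + k))       ≤⟨ ^-monoʳ-≤ 2 exponents ⟩
    2 ^ (K * 12)                ∎
    where
    regroup : ∀ a → 4 * a ≡ 2 * (2 * a)
    regroup = solve-∀
    collect : ∀ K → K * 2 + K + (K * 2 + K) ≡ K * 6
    collect = solve-∀
    2≤K*2 : 2 ≤ K * 2
    2≤K*2 = *-monoˡ-≤ 2 1≤K
    exponents : 2 + K + (2 + k) ≤ K * 12
    exponents = begin
      2 + K + (2 + k)           ≤⟨ +-mono-≤ (+-monoˡ-≤ K 2≤K*2) (+-mono-≤ 2≤K*2 k≤K) ⟩
      K * 2 + K + (K * 2 + K)   ≡⟨ collect K ⟩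
      K * 6                     ≤⟨ *-monoʳ-≤ K (m≤m+n 6 6) ⟩
      K * 12                    ∎

  -- Here the moment bound is 2^(-16sK), and the threshold uses up 12sK of the exponent. The
  -- remaining 4sK covers 2 + K + s, where s ≤ 2^s takes care of the weight.
  spare-slack : 4 * 2 ^ K * (s * 2 ^ (s * K * 12)) ≤ 2 ^ (s * K * 16)
  spare-slack = begin
    4 * 2 ^ K * (s * 2 ^ (s * K * 12))        ≤⟨ *-monoʳ-≤ (4 * 2 ^ K) (*-monoˡ-≤ _ (n≤2^n s)) ⟩
    4 * 2 ^ K * (2 ^ s * 2 ^ (s * K * 12))    ≡⟨ cong (4 * 2 ^ K *_) (^-distribˡ-+-* 2 s _) ⟨
    4 * 2 ^ K * 2 ^ (s + s * K * 12)          ≡⟨ 2^-distrib₄ K (s + s * K * 12) ⟩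
    2 ^ (2 + K + (s + s * K * 12))            ≤⟨ ^-monoʳ-≤ 2 exponents ⟩
    2 ^ (s * K * 16)                          ∎
    where
    1≤s : 1 ≤ s
    1≤s = >-nonZero⁻¹ s
    K≤s*K : K ≤ s * K
    K≤s*K = m≤n*m K s
    s≤s*K : s ≤ s * K
    s≤s*K = m≤m*n s K {{>-nonZero 1≤K}}
    collect : ∀ q → q * 2 + q + (q + q * 12) ≡ q * 16
    collect = solve-∀
    exponents : 2 + K + (s + s * K * 12) ≤ s * K * 16
    exponents = begin
      2 + K + (s + s * K * 12)
        ≤⟨ +-mono-≤ (+-mono-≤ (*-monoˡ-≤ 2 (≤-trans 1≤s s≤s*K)) K≤s*K) (+-monoˡ-≤ _ s≤s*K) ⟩
      s * K * 2 + s * K + (s * K + s * K * 12)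
        ≡⟨ collect (s * K) ⟩
      s * K * 16 ∎

  s*4≢0 : NonZero (s * 4)
  s*4≢0 = m*n≢0 s 4

  -- The power 12K of (1 - 1/(4s))^(4s) ≤ 1/2.
  own-ratio : 2 ^ (K * 12) * pred (s * 4) ^ (s * 4 * (K * 12)) ≤ (s * 4) ^ (s * 4 * (K * 12))
  own-ratio = ratio-power (s * 4) (K * 12)
    (subst (λ b → 2 * pred (s * 4) ^ b ≤ b ^ b) (suc-pred (s * 4) {{s*4≢0}}) (2*d^[1+d]≤[1+d]^[1+d] (pred (s * 4))))

  -- The power 16sK of (3/4)^3 = 27/64 ≤ 1/2.
  spare-ratio : 2 ^ (s * K * 16) * (s * 3) ^ (3 * (s * K * 16)) ≤ (s * 4) ^ (3 * (s * K * 16))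
  spare-ratio = ratio-power {2} {s * 3} {s * 4} 3 (s * K * 16) (begin
    2 * (s * 3) ^ 3            ≡⟨ cube₃ s ⟩
    s * s * s * 54             ≤⟨ *-monoʳ-≤ (s * s * s) (m≤m+n 54 10) ⟩
    s * s * s * 64             ≡⟨ cube₄ s ⟩
    (s * 4) ^ 3                ∎)
    where
    cube₃ : ∀ s → 2 * (s * 3 * (s * 3 * (s * 3 * 1))) ≡ s * s * s * 54
    cube₃ = solve-∀
    cube₄ : ∀ s → s * s * s * 64 ≡ s * 4 * (s * 4 * (s * 4 * 1))
    cube₄ = solve-∀

  -- The list size 48sK equals both 4s * 12K and 3 * 16sK, the exponents of the two ratio bounds.
  expected-≤ : ∀ j → 4 * 2 ^ K * (coefficient j * expected j) ≤ (s * 4) ^ N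
  expected-≤ (v , true) = begin
    4 * 2 ^ K * (4 * 2 ^ k * expected (v , true))     ≡⟨ *-assoc (4 * 2 ^ K) (4 * 2 ^ k) _ ⟨
    4 * 2 ^ K * (4 * 2 ^ k) * expected (v , true)     ≤⟨ *-monoˡ-≤ (expected (v , true)) own-slack ⟩
    2 ^ (K * 12) * expected (v , true)
      ≡⟨ cong (2 ^ (K * 12) *_) (product-cong-≗ (∑₂-own σ S v)) ⟩
    2 ^ (K * 12) * product (λ x → if S v x then pred (s * 4) else s * 4)
      ≤⟨ product-if-≤ (S v) {c = 2 ^ (K * 12)} {{s*4≢0}} pred[n]≤n own-ratio
           (≤-trans (≤-reflexive (regroup s K)) (large v)) ⟩
    (s * 4) ^ N ∎
    where
    regroup : ∀ s K → s * 4 * (K * 12) ≡ s * K * 48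
    regroup = solve-∀
  expected-≤ (v , false) = begin
    4 * 2 ^ K * (s * 2 ^ (s * K * 12) * expected (v , false))
      ≡⟨ *-assoc (4 * 2 ^ K) (s * 2 ^ (s * K * 12)) _ ⟨
    4 * 2 ^ K * (s * 2 ^ (s * K * 12)) * expected (v , false)
      ≤⟨ *-monoˡ-≤ (expected (v , false)) spare-slack ⟩
    2 ^ (s * K * 16) * expected (v , false)
      ≡⟨ cong (2 ^ (s * K * 16) *_) (product-cong-≗ (∑₂-spare σ S v)) ⟩
    2 ^ (s * K * 16) * product (λ x → if S v x then s * 3 else s * 4)
      ≤⟨ product-if-≤ (S v) {c = 2 ^ (s * K * 16)} {{s*4≢0}} (*-monoʳ-≤ s (m≤m+n 3 1)) spare-ratio
           (≤-trans (≤-reflexive (regroup (s * K))) (large v)) ⟩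
    (s * 4) ^ N ∎
    where
    regroup : ∀ q → 3 * (q * 16) ≡ q * 48
    regroup = solve-∀

  -- There are 2p ≤ 2 * 2^K * s terms, each at most (4s)^N / (4 * 2^K).
  ∑₂-expected-≤ : 2 * ∑₂ (λ j → coefficient j * expected j) ≤ s * (s * 4) ^ N
  ∑₂-expected-≤ = *-cancelˡ-≤ (2 ^ K * 2) {{m*n≢0 (2 ^ K) 2 {{m^n≢0 2 K}}}} (begin
    2 ^ K * 2 * (2 * X)                                 ≡⟨ regroup₁ (2 ^ K) X ⟩
    4 * 2 ^ K * X                                       ≡⟨ *-distribˡ-∑₂ (4 * 2 ^ K) (λ j → coefficient j * expected j) ⟩
    ∑₂ (λ j → 4 * 2 ^ K * (coefficient j * expected j)) ≤⟨ ∑₂-mono-≤ expected-≤ ⟩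
    ∑₂ {p} (λ _ → U)                                    ≡⟨ cong₂ _+_ (sum-const p U) (sum-const p U) ⟩
    p * U + p * U                                       ≤⟨ +-mono-≤ (*-monoˡ-≤ U p≤2^K*s) (*-monoˡ-≤ U p≤2^K*s) ⟩
    2 ^ K * s * U + 2 ^ K * s * U                       ≡⟨ regroup₂ (2 ^ K) s U ⟩
    2 ^ K * 2 * (s * U)                                 ∎)
    where
    X = ∑₂ (λ j → coefficient j * expected j)
    U = (s * 4) ^ N
    regroup₁ : ∀ q x → q * 2 * (2 * x) ≡ 4 * q * x
    regroup₁ = solve-∀
    regroup₂ : ∀ q s u → q * s * u + q * s * u ≡ q * 2 * (s * u)
    regroup₂ = solve-∀

  -- Markov's argument: if X is below the threshold t, then 2^t * 2^-X ≥ 1, so the indicator is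
  -- dominated by the exponential.
  deficient-≤ : ∀ g j → 2 ^ N * (weight (proj₂ j) * (if deficient g j then 1 else 0)) ≤ coefficient j * attained g j
  deficient-≤ g j@(v , b) with count (received g j) <ᵇ threshold b in few
  ... | false = ≤-trans (≤-reflexive (trans (cong (2 ^ N *_) (*-zeroʳ (weight b))) (*-zeroʳ (2 ^ N)))) z≤n
  ... | true = begin
    2 ^ N * (weight b * 1)                              ≡⟨ regroup (2 ^ N) (weight b) ⟩
    weight b * (1 * 2 ^ N)                              ≡⟨ cong (λ o → weight b * (o * 2 ^ N)) (^-zeroˡ c) ⟨
    weight b * (1 ^ c * 2 ^ N)                          ≡⟨ cong (weight b *_) (product-if (received g j) 1 2) ⟨
    weight b * (2 ^ c * attained g j)
      ≤⟨ *-monoʳ-≤ (weight b) (*-monoˡ-≤ (attained g j) (^-monoʳ-≤ 2 (<⇒≤ (<ᵇ-true {c} {threshold b} few)))) ⟩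
    weight b * (2 ^ threshold b * attained g j)         ≡⟨ *-assoc (weight b) _ _ ⟨
    coefficient j * attained g j                        ∎
    where
    c = count (received g j)
    regroup : ∀ x w → x * (w * 1) ≡ w * (1 * x)
    regroup = solve-∀

  good-assignment : ∃ λ g → 8 * count (λ v → deficient g (v , true)) ≤ s ×
                            (∀ v → s * K * 12 ≤ count (received g (v , false)))
  good-assignment = g , 8*own≤s , spare-large
    where
    outcome = exists-below-average coefficient (λ j x c → if hit σ S j x c then 1 else 2)
    g = proj₁ outcome
    own = count (λ v → deficient g (v , true))
    spare = count (λ v → deficient g (v , false))
    Y = ∑₂ (λ j → coefficient j * attained g j)

    Y-lower : 2 ^ N * (4 * own + s * spare) ≤ Y
    Y-lower = begin
      2 ^ N * (4 * own + s * spare)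
        ≡⟨ cong (2 ^ N *_) (cong₂ _+_ (*-distribˡ-sum 4 (λ v → if deficient g (v , true) then 1 else 0))
                                      (*-distribˡ-sum s (λ v → if deficient g (v , false) then 1 else 0))) ⟩
      2 ^ N * ∑₂ (λ j → weight (proj₂ j) * (if deficient g j then 1 else 0))
        ≡⟨ *-distribˡ-∑₂ (2 ^ N) (λ j → weight (proj₂ j) * (if deficient g j then 1 else 0)) ⟩
      ∑₂ (λ j → 2 ^ N * (weight (proj₂ j) * (if deficient g j then 1 else 0)))
        ≤⟨ ∑₂-mono-≤ (deficient-≤ g) ⟩
      Y ∎

    Y-upper : 2 * Y ≤ s * 2 ^ N
    Y-upper = *-cancelˡ-≤ ((s + s) ^ N) {{m^n≢0 (s + s) N {{>-nonZero (≤-trans (>-nonZero⁻¹ s) (m≤m+n s s))}}}} (begin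
      (s + s) ^ N * (2 * Y)             ≡⟨ *-left-comm ((s + s) ^ N) 2 Y ⟩
      2 * ((s + s) ^ N * Y)             ≤⟨ *-monoʳ-≤ 2 (proj₂ outcome) ⟩
      2 * ∑₂ (λ j → coefficient j * expected j) ≤⟨ ∑₂-expected-≤ ⟩
      -- The scale (4s)^N splits into the number (2s)^N of assignments, which cancels, and the scale
      -- 2^N of `attained`.
      s * (s * 4) ^ N                   ≡⟨ cong (λ b → s * b ^ N) (s*4≡ s) ⟩
      s * ((s + s) * 2) ^ N             ≡⟨ cong (s *_) (^-distribʳ-* N (s + s) 2) ⟩
      s * ((s + s) ^ N * 2 ^ N)         ≡⟨ *-left-comm s ((s + s) ^ N) (2 ^ N) ⟩
      (s + s) ^ N * (s * 2 ^ N)         ∎)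
      where
      s*4≡ : ∀ s → s * 4 ≡ (s + s) * 2
      s*4≡ = solve-∀

    few : 2 * (4 * own + s * spare) ≤ s
    few = *-cancelˡ-≤ (2 ^ N) {{m^n≢0 2 N}} (begin
      2 ^ N * (2 * (4 * own + s * spare))   ≡⟨ *-left-comm (2 ^ N) 2 _ ⟩
      2 * (2 ^ N * (4 * own + s * spare))   ≤⟨ *-monoʳ-≤ 2 Y-lower ⟩
      2 * Y                                 ≤⟨ Y-upper ⟩
      s * 2 ^ N                             ≡⟨ *-comm s (2 ^ N) ⟩
      2 ^ N * s                             ∎)

    8*own≤s : 8 * own ≤ s
    8*own≤s = begin
      8 * own                       ≤⟨ m≤m+n (8 * own) (2 * (s * spare)) ⟩
      8 * own + 2 * (s * spare)     ≡⟨ regroup own (s * spare) ⟩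
      2 * (4 * own + s * spare)     ≤⟨ few ⟩
      s                             ∎
      where
      regroup : ∀ a b → 8 * a + 2 * b ≡ 2 * (4 * a + b)
      regroup = solve-∀

    spare≡0 : spare ≡ 0
    spare≡0 = n<1⇒n≡0 (*-cancelˡ-< (s * 2) spare 1 (begin-strict
      s * 2 * spare                 ≤⟨ m≤n+m _ (8 * own) ⟩
      8 * own + s * 2 * spare       ≡⟨ regroup own s spare ⟩
      2 * (4 * own + s * spare)     ≤⟨ few ⟩
      s                             <⟨ m<m*n s 2 (s≤s (s≤s z≤n)) ⟩
      s * 2                         ≡⟨ *-identityʳ (s * 2) ⟨
      s * 2 * 1                     ∎))
      where
      regroup : ∀ a s b → 8 * a + s * 2 * b ≡ 2 * (4 * a + s * b)
      regroup = solve-∀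

    spare-large : ∀ v → s * K * 12 ≤ count (received g (v , false))
    spare-large v = <ᵇ-false (count≡0⇒false (λ v → deficient g (v , false)) spare≡0 v)

-- Recursive selection of the colour sets

∧-trueˡ : ∀ a {b} → a ∧ b ≡ true → a ≡ true
∧-trueˡ true _ = refl

∧-trueʳ : ∀ a {b} → a ∧ b ≡ true → b ≡ true
∧-trueʳ true eq = eq

-- Only vertices in different slots conflict: at the top level slots are the vertex classes, and in
-- recursive calls each vertex is its own slot.
record Selection {p s N} (σ : Fin p → Fin s) (S : Fin p → Fin N → Bool) (k : ℕ) : Set where
  field
    chosen   : Fin p → Fin N → Bool
    ⊆-list   : ∀ v x → chosen v x ≡ true → S v x ≡ true
    size     : ∀ v → k ≤ count (chosen v)
    disjoint : ∀ u v x → σ u ≢ σ v → chosen u x ≡ true → chosen v x ≡ true → ⊥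

select : ∀ {K k} → 1 ≤ K → k ≤ K → ∀ s → Acc _<_ s → ∀ {p N} → p ≤ 2 ^ K * s →
         (σ : Fin p → Fin s) (S : Fin p → Fin N → Bool) → (∀ v → s * K * 48 ≤ count (S v)) → Selection σ S k
-- Without slots there are no vertices, since `σ` maps into an empty type.
select 1≤K k≤K zero _ _ σ S _ = record
  { chosen   = λ v → contradiction (σ v) Fin.¬Fin0
  ; ⊆-list   = λ v → contradiction (σ v) Fin.¬Fin0
  ; size     = λ v → contradiction (σ v) Fin.¬Fin0
  ; disjoint = λ v → contradiction (σ v) Fin.¬Fin0
  }
select {K} {k} 1≤K k≤K s@(suc _) (acc smaller) {p} {N} p≤ σ S large = record
  { chosen   = λ v → choose v (bad v) refl
  ; ⊆-list   = λ v → choose-⊆ v (bad v) refl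
  ; size     = λ v → choose-size v (bad v) refl
  ; disjoint = λ u v → choose-disjoint u v (bad u) refl (bad v) refl
  }
  where
  open Round 1≤K k≤K p≤ σ S large
  g = proj₁ good-assignment

  bad : Fin p → Bool
  bad v = deficient g (v , true)

  s′ = count bad
  open Enumeration (enumerate bad)

  8*s′≤s : 8 * s′ ≤ s
  8*s′≤s = proj₁ (proj₂ good-assignment)

  s′<s : s′ < s
  s′<s = *-cancelˡ-< 8 s′ s (≤-<-trans 8*s′≤s (subst (s <_) (*-comm s 8) (m<m*n s 8 (s≤s (s≤s z≤n)))))

  large′ : ∀ i → s′ * K * 48 ≤ count (received g (element i , false))
  large′ i = begin
    s′ * K * 48               ≤⟨ m≤m+n _ (s′ * K * 48) ⟩
    s′ * K * 48 + s′ * K * 48 ≡⟨ regroup s′ K ⟩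
    8 * s′ * K * 12           ≤⟨ *-monoˡ-≤ 12 (*-monoˡ-≤ K 8*s′≤s) ⟩
    s * K * 12                ≤⟨ proj₂ (proj₂ good-assignment) (element i) ⟩
    count (received g (element i , false)) ∎
    where
    regroup : ∀ s K → s * K * 48 + s * K * 48 ≡ 8 * s * K * 12
    regroup = solve-∀

  rest : Selection (λ i → i) (λ i → received g (element i , false)) k
  -- With one slot per vertex, the bound on the number of vertices becomes s′ ≤ 2^K * s′.
  rest = select 1≤K k≤K s′ (smaller s′<s) (m≤n*m s′ (2 ^ K) {{m^n≢0 2 K}}) (λ i → i) _ large′
  module Rest = Selection rest

  -- The flag and its equation are arguments, so that the facts about `choose` can split on the flag
  -- while keeping the proof that `index` asks for.
  choose : ∀ v b → bad v ≡ b → Fin N → Bool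
  choose v true  v-bad = Rest.chosen (index v v-bad)
  choose v false _     = received g (v , true)

  spared : ∀ v v-bad x → choose v true v-bad x ≡ true → received g (v , false) x ≡ true
  spared v v-bad x chosen = subst (λ w → received g (w , false) x ≡ true) (element-index v v-bad)
                                  (Rest.⊆-list _ x chosen)

  choose-⊆ : ∀ v b eq x → choose v b eq x ≡ true → S v x ≡ true
  choose-⊆ v true  v-bad x chosen = ∧-trueˡ (S v x) (spared v v-bad x chosen)
  choose-⊆ v false _     x chosen = ∧-trueˡ (S v x) chosen

  choose-size : ∀ v b eq → k ≤ count (choose v b eq)
  choose-size v true  v-bad  = Rest.size (index v v-bad)
  choose-size v false v-good = <ᵇ-false v-good

  own-spare-disjoint : ∀ u v x → received g (u , true) x ≡ true → received g (v , false) x ≡ true → ⊥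
  own-spare-disjoint u v x own spare with proj₂ (g x) | ∧-trueʳ (S u x) own | ∧-trueʳ (S v x) spare
  ... | true  | _  | ()
  ... | false | () | _

  own-slot : ∀ v x → received g (v , true) x ≡ true → proj₁ (g x) ≡ σ v
  own-slot v x own with proj₁ (g x) ≟ σ v | ∧-trueʳ (proj₂ (g x)) (∧-trueʳ (S v x) own)
  ... | yes eq | _ = eq

  choose-disjoint : ∀ u v b eq c eq′ x → σ u ≢ σ v → choose u b eq x ≡ true → choose v c eq′ x ≡ true → ⊥
  -- Different slots force different vertices, hence different indices, which are the slots of the
  -- recursive call.
  choose-disjoint u v true u-bad true v-bad x σu≢σv = Rest.disjoint _ _ x λ same →
    σu≢σv (cong σ (trans (sym (element-index u u-bad)) (trans (cong element same) (element-index v v-bad))))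
  choose-disjoint u v true  u-bad false _     x _ pu pv = own-spare-disjoint v u x pv (spared u u-bad x pu)
  choose-disjoint u v false _     true  v-bad x _ pu pv = own-spare-disjoint u v x pu (spared v v-bad x pv)
  -- A colour goes to a single slot, so two winners of it share that slot.
  choose-disjoint u v false _     false _     x σu≢σv pu pv =
    σu≢σv (trans (sym (own-slot u x pu)) (own-slot v x pv))

-- Partial sums of the exponential series: e ≤ 4

-- The partial sums of e^(y/2), cleared of denominators: halfExp y N = Σ_{i≤N} y^i 2^(N-i) N!/i!.
-- Half-integer steps are used because e^h ≤ 1 + h e^h bounds e^h only for h < 1; h = 1/2 gives e^h ≤ 2.
halfExp : ℕ → ℕ → ℕ
halfExp y zero    = 1
halfExp y (suc N) = 2 * suc N * halfExp y N + y ^ suc N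

-- The mean value bound for t^(i+1) on the interval from y to y + 1.
[1+y]^[1+i]-≤ : ∀ y i → suc y ^ suc i ≤ y ^ suc i + suc i * suc y ^ i
[1+y]^[1+i]-≤ y zero    = ≤-reflexive (base y)
  where
  base : ∀ y → suc y * 1 ≡ y * 1 + 1 * 1
  base = solve-∀
[1+y]^[1+i]-≤ y (suc i) = begin
  X + y * X                                             ≤⟨ +-monoʳ-≤ X (*-monoʳ-≤ y ([1+y]^[1+i]-≤ y i)) ⟩
  X + y * (y ^ suc i + suc i * suc y ^ i)               ≡⟨ expand X y (y ^ suc i) i (suc y ^ i) ⟩
  y * y ^ suc i + (X + suc i * (y * suc y ^ i))
    ≤⟨ +-monoʳ-≤ (y * y ^ suc i) (+-monoʳ-≤ X (*-monoʳ-≤ (suc i) (m≤n+m _ (suc y ^ i)))) ⟩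
  y * y ^ suc i + (X + suc i * X)                       ∎
  where
  X = suc y ^ suc i
  expand : ∀ X y Y i Z → X + y * (Y + suc i * Z) ≡ y * Y + (X + suc i * (y * Z))
  expand = solve-∀

-- The mean value bound summed over the series. For the partial sums S it says S_(N+1)((y+1)/2) ≤
-- S_(N+1)(y/2) + S_N((y+1)/2)/2.
halfExp-increment : ∀ y N → halfExp (suc y) (suc N) ≤ halfExp y (suc N) + suc N * halfExp (suc y) N
halfExp-increment y zero    = ≤-reflexive (base y)
  where
  base : ∀ y → 2 * 1 * 1 + suc y * 1 ≡ 2 * 1 * 1 + y * 1 + 1 * 1
  base = solve-∀
halfExp-increment y (suc N) = begin
  2 * suc (suc N) * halfExp (suc y) (suc N) + suc y ^ suc (suc N)
    ≤⟨ +-mono-≤ (*-monoʳ-≤ (2 * suc (suc N)) (halfExp-increment y N)) ([1+y]^[1+i]-≤ y (suc N)) ⟩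
  2 * suc (suc N) * (halfExp y (suc N) + suc N * halfExp (suc y) N) + (y ^ suc (suc N) + suc (suc N) * suc y ^ suc N)
    ≡⟨ regroup N (halfExp y (suc N)) (halfExp (suc y) N) (y ^ suc (suc N)) (suc y ^ suc N) ⟩
  halfExp y (suc (suc N)) + suc (suc N) * halfExp (suc y) (suc N) ∎
  where
  regroup : ∀ N F F′ Y Y′ → 2 * suc (suc N) * (F + suc N * F′) + (Y + suc (suc N) * Y′)
                          ≡ 2 * suc (suc N) * F + Y + suc (suc N) * (2 * suc N * F′ + Y′)
  regroup = solve-∀

-- Bounding S_N by S_(N+1) in the increment puts half of the left side on the right; absorbing it
-- costs a factor 2.
halfExp-double : ∀ y N → halfExp (suc y) N ≤ 2 * halfExp y N
halfExp-double y zero    = s≤s z≤n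
halfExp-double y (suc N) = +-cancelʳ-≤ F′ F′ (2 * F) (begin
  F′ + F′                                           ≡⟨ cong (F′ +_) (+-identityʳ F′) ⟨
  2 * F′                                            ≤⟨ *-monoʳ-≤ 2 (halfExp-increment y N) ⟩
  2 * (F + suc N * halfExp (suc y) N)               ≡⟨ regroup F N (halfExp (suc y) N) ⟩
  2 * F + 2 * suc N * halfExp (suc y) N             ≤⟨ +-monoʳ-≤ (2 * F) (m≤m+n _ (suc y ^ suc N)) ⟩
  2 * F + F′                                        ∎)
  where
  F  = halfExp y (suc N)
  F′ = halfExp (suc y) (suc N)
  regroup : ∀ F N G → 2 * (F + suc N * G) ≡ 2 * F + 2 * suc N * G
  regroup = solve-∀

halfExp-0 : ∀ N → halfExp 0 N ≡ 2 ^ N * N !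
halfExp-0 zero    = refl
halfExp-0 (suc N) = trans (+-identityʳ _) (trans (cong (2 * suc N *_) (halfExp-0 N)) (regroup N (2 ^ N) (N !)))
  where
  regroup : ∀ N P F → 2 * suc N * (P * F) ≡ 2 * P * (suc N * F)
  regroup = solve-∀

halfExp-≤ : ∀ y N → halfExp y N ≤ 2 ^ y * (2 ^ N * N !)
halfExp-≤ zero    N = ≤-reflexive (trans (halfExp-0 N) (sym (*-identityˡ _)))
halfExp-≤ (suc y) N = begin
  halfExp (suc y) N             ≤⟨ halfExp-double y N ⟩
  2 * halfExp y N               ≤⟨ *-monoʳ-≤ 2 (halfExp-≤ y N) ⟩
  2 * (2 ^ y * (2 ^ N * N !))   ≡⟨ *-assoc 2 (2 ^ y) _ ⟨
  2 ^ suc y * (2 ^ N * N !)     ∎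

halfExp-expSc : ∀ j N → halfExp (2 * j) N ≡ 2 ^ N * expSc j N
halfExp-expSc j zero    = refl
halfExp-expSc j (suc N) = begin-equality
  2 * suc N * halfExp (2 * j) N + (2 * j) ^ suc N
    ≡⟨ cong₂ (λ a b → 2 * suc N * a + b) (halfExp-expSc j N) (^-distribʳ-* (suc N) 2 j) ⟩
  2 * suc N * (2 ^ N * expSc j N) + 2 ^ suc N * j ^ suc N
    ≡⟨ regroup N (2 ^ N) (expSc j N) (j ^ suc N) ⟩
  2 ^ suc N * expSc j (suc N) ∎
  where
  regroup : ∀ N P E J → 2 * suc N * (P * E) + 2 * P * J ≡ 2 * P * (suc N * E + J)
  regroup = solve-∀

expSc-≤ : ∀ j N → expSc j N ≤ 2 ^ (2 * j) * N !
expSc-≤ j N = *-cancelˡ-≤ (2 ^ N) {{m^n≢0 2 N}} (begin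
  2 ^ N * expSc j N               ≡⟨ halfExp-expSc j N ⟨
  halfExp (2 * j) N               ≤⟨ halfExp-≤ (2 * j) N ⟩
  2 ^ (2 * j) * (2 ^ N * N !)     ≡⟨ *-left-comm (2 ^ (2 * j)) (2 ^ N) (N !) ⟩
  2 ^ N * (2 ^ (2 * j) * N !)     ∎)

-- The numerical bound

-- The chain is e^j ≤ 2^(2j) ≤ 2^(ℓR) ≤ (M/r)^R.
exp-bound : ∀ {r M ℓ R} j N → 2 ^ ℓ * r ≤ M → 2 * j ≤ ℓ * R → r ^ R * expSc j N ≤ M ^ R * N !
exp-bound {r} {M} {ℓ} {R} j N 2^ℓ*r≤M 2j≤ℓR = begin
  r ^ R * expSc j N               ≤⟨ *-monoʳ-≤ (r ^ R) (expSc-≤ j N) ⟩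
  r ^ R * (2 ^ (2 * j) * N !)     ≤⟨ *-monoʳ-≤ (r ^ R) (*-monoˡ-≤ (N !) (^-monoʳ-≤ 2 2j≤ℓR)) ⟩
  r ^ R * (2 ^ (ℓ * R) * N !)     ≡⟨ cong (λ P → r ^ R * (P * N !)) (^-*-assoc 2 ℓ R) ⟨
  r ^ R * ((2 ^ ℓ) ^ R * N !)     ≡⟨ *-left-comm (r ^ R) ((2 ^ ℓ) ^ R) (N !) ⟩
  (2 ^ ℓ) ^ R * (r ^ R * N !)     ≡⟨ *-assoc ((2 ^ ℓ) ^ R) (r ^ R) (N !) ⟨
  (2 ^ ℓ) ^ R * r ^ R * N !       ≡⟨ cong (_* N !) (^-distribʳ-* R (2 ^ ℓ) r) ⟨
  (2 ^ ℓ * r) ^ R * N !           ≤⟨ *-monoˡ-≤ (N !) (^-monoˡ-≤ R 2^ℓ*r≤M) ⟩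
  M ^ R * N !                     ∎

-- Since R ≥ 48r, the term Rk absorbs 48rk and leaves an excess of at most 48rℓ. Its double is 96rℓ,
-- whence the constant 96.
excess-bound : ∀ {r R} k ℓ → r * 96 ≤ R → 2 * (r * (k + ℓ) * 48 ∸ R * k) ≤ ℓ * R
excess-bound {r} {R} k ℓ r*96≤R = begin
  2 * (r * (k + ℓ) * 48 ∸ R * k)    ≤⟨ *-monoʳ-≤ 2 (m≤n+o⇒m∸n≤o _ (R * k) split) ⟩
  2 * (r * ℓ * 48)                  ≡⟨ regroup r ℓ ⟩
  ℓ * (r * 96)                      ≤⟨ *-monoʳ-≤ ℓ r*96≤R ⟩
  ℓ * R                             ∎
  where
  regroup : ∀ r ℓ → 2 * (r * ℓ * 48) ≡ ℓ * (r * 96)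
  regroup = solve-∀
  distribute : ∀ r k ℓ → r * (k + ℓ) * 48 ≡ r * 48 * k + r * ℓ * 48
  distribute = solve-∀
  split : r * (k + ℓ) * 48 ≤ R * k + r * ℓ * 48
  split = begin
    r * (k + ℓ) * 48          ≡⟨ distribute r k ℓ ⟩
    r * 48 * k + r * ℓ * 48   ≤⟨ +-monoˡ-≤ _ (*-monoˡ-≤ k (≤-trans (*-monoʳ-≤ r (m≤m+n 48 48)) r*96≤R)) ⟩
    R * k + r * ℓ * 48        ∎

leBound : ∀ {r M} k ℓ → 2 ^ ℓ * r ≤ M → LeBound r k M (r * (k + ℓ) * 48)
leBound {r} {M} k ℓ 2^ℓ*r≤M =
    (λ _ N → exp-bound {ℓ = ℓ} _ N 2^ℓ*r≤M (excess-bound {r} k ℓ r*96≤948*r))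
  -- The zeroth partial sum is 1, which is enough because r ≤ M.
  , (λ _ → 0 , *-monoˡ-≤ 1 (^-monoˡ-≤ (948 * r) (≤-trans (m≤n*m r (2 ^ ℓ) {{m^n≢0 2 ℓ}}) 2^ℓ*r≤M)))
  where
  r*96≤948*r : r * 96 ≤ 948 * r
  r*96≤948*r = ≤-trans (*-monoʳ-≤ r (m≤m+n 96 852)) (≤-reflexive (*-comm r 948))

floor-log₂ : ∀ {r M} → 1 ≤ r → r ≤ M → ∃ λ ℓ → 2 ^ ℓ * r ≤ M × M ≤ 2 ^ suc ℓ * r
-- The search runs downwards from the exponent M + 1, which is large enough because M < 2^(M+1).
floor-log₂ {r} {M} 1≤r r≤M = descend (suc M) (≤-trans (n≤2^n (suc M)) (m≤m*n _ r {{>-nonZero 1≤r}}))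
  where
  descend : ∀ d → M < 2 ^ d * r → ∃ λ ℓ → 2 ^ ℓ * r ≤ M × M ≤ 2 ^ suc ℓ * r
  descend zero    M<r = contradiction r≤M (<⇒≱ (subst (M <_) (*-identityˡ r) M<r))
  descend (suc d) M<  with 2 ^ d * r ≤? M
  ... | yes ≤M = d , ≤M , <⇒≤ M<
  ... | no  ≰M = descend d (≰⇒> ≰M)

-- From the multipartite graph to slots and back

total-suc : ∀ r (m : Fin (suc r) → ℕ) → total (suc r) m ≡ m zero + total r (m ∘ suc)
total-suc r m = cong (λ xs → m zero + List.sum xs) (trans (map-tabulate suc m) (sym (map-tabulate (λ i → i) (m ∘ suc))))

r≤total : ∀ r (m : Fin r → ℕ) → (∀ i → 1 ≤ m i) → r ≤ total r m
r≤total zero    m 1≤m = z≤n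
r≤total (suc r) m 1≤m = ≤-trans (+-mono-≤ (1≤m zero) (r≤total r (m ∘ suc) (1≤m ∘ suc))) (≤-reflexive (sym (total-suc r m)))

-- The right inverse of `decode` gives each vertex a code at which it reads its colours.
flatten : ∀ r (m : Fin r → ℕ) → ∃ λ (decode : Fin (total r m) → KVertex r m) → ∀ v → ∃ λ i → decode i ≡ v
flatten zero    m = (λ ()) , λ ()
flatten (suc r) m = subst (λ n → ∃ λ (decode : Fin n → KVertex (suc r) m) → ∀ v → ∃ λ i → decode i ≡ v)
                          (sym (total-suc r m)) (decode , encode)
  where
  n = total r (m ∘ suc)
  rest = flatten r (m ∘ suc)

  inject : Fin (m zero) ⊎ Fin n → KVertex (suc r) m
  inject (inj₁ a) = zero , a
  inject (inj₂ j) = suc (proj₁ (proj₁ rest j)) , proj₂ (proj₁ rest j)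

  decode : Fin (m zero + n) → KVertex (suc r) m
  decode = inject ∘ splitAt (m zero)

  encode : ∀ v → ∃ λ i → decode i ≡ v
  encode (zero  , a) = a ↑ˡ n , cong inject (Fin.splitAt-↑ˡ (m zero) a n)
  encode (suc i , a) with proj₂ rest (i , a)
  ... | j , eq = m zero ↑ʳ j , trans (cong inject (Fin.splitAt-↑ʳ (m zero) n j))
                                     (cong (λ v → suc (proj₁ v) , proj₂ v) eq)

does-true : ∀ {A : Set} (a? : Dec A) → does a? ≡ true → A
does-true (yes a) _ = a

choosable : ∀ {r k K} {m : Fin r → ℕ} → 1 ≤ K → k ≤ K → total r m ≤ 2 ^ K * r →
            Choosable (KVertex r m) (KAdj r m) (r * K * 48) k
choosable {r} {k} {K} {m} 1≤K k≤K total≤ S S-injective = C , C-injective , C-disjoint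
  where
  n = r * K * 48
  p = total r m

  decode : Fin p → KVertex r m
  decode = proj₁ (flatten r m)

  encode : KVertex r m → Fin p
  encode v = proj₁ (proj₂ (flatten r m) v)

  decode-encode : ∀ v → decode (encode v) ≡ v
  decode-encode v = proj₂ (proj₂ (flatten r m) v)

  -- Colours are arbitrary naturals; exceeding the sum of all list entries makes `B` exceed each of
  -- them, so the palette becomes `Fin B`.
  B = suc (sum (λ i → sum (S (decode i))))

  bounded : ∀ i a → S (decode i) a < B
  bounded i a = s≤s (≤-trans (term≤sum (S (decode i)) a) (term≤sum (λ i → sum (S (decode i))) i))

  member? : ∀ i x → Dec (∃ λ a → S (decode i) a ≡ toℕ x)
  member? i x = Fin.any? (λ a → S (decode i) a ℕ.≟ toℕ x)

  list : Fin p → Fin B → Bool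
  list i x = does (member? i x)

  list-large : ∀ i → n ≤ count (list i)
  list-large i = injection⇒≤count (list i) (λ a → fromℕ< (bounded i a))
    (λ {a} {b} eq → S-injective (decode i) (Fin.fromℕ<-injective _ _ (bounded i a) (bounded i b) eq))
    (λ a → dec-true (member? i _) (a , sym (Fin.toℕ-fromℕ< (bounded i a))))

  open Selection (select 1≤K k≤K r (<-wellFounded r) total≤ (proj₁ ∘ decode) list list-large)

  module E i = Enumeration (enumerate (chosen i))

  colour : Fin p → Fin k → Fin B
  colour i j = E.element i (inject≤ j (size i))

  position : ∀ i j → ∃ λ a → S (decode i) a ≡ toℕ (colour i j)
  position i j = does-true (member? i _) (⊆-list i _ (E.satisfies i (inject≤ j (size i))))

  C : KVertex r m → Fin k → Fin n
  C v j = proj₁ (position (encode v) j)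

  S-C : ∀ v j → S v (C v j) ≡ toℕ (colour (encode v) j)
  -- `C v j` was found in the list of `decode (encode v)`; list positions have the same type `Fin n`
  -- for all vertices, so the equation transports to `v`.
  S-C v j = subst (λ w → S w (C v j) ≡ toℕ (colour (encode v) j)) (decode-encode v) (proj₂ (position (encode v) j))

  C-injective : ∀ v → Injective _≡_ _≡_ (C v)
  C-injective v {x} {y} eq = Fin.inject≤-injective (size i) (size i) x y (E.element-injective i
    (Fin.toℕ-injective (trans (sym (S-C v x)) (trans (cong (S v) eq) (S-C v y)))))
    where i = encode v

  C-disjoint : ∀ u v → KAdj r m u v → ∀ x y → S u (C u x) ≢ S v (C v y)
  C-disjoint u v adjacent x y eq = disjoint (encode u) (encode v) (colour (encode u) x)
    (λ same → adjacent (trans (cong proj₁ (sym (decode-encode u))) (trans same (cong proj₁ (decode-encode v)))))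
    (E.satisfies (encode u) _)
    (subst (λ c → chosen (encode v) c ≡ true) (sym same-colour) (E.satisfies (encode v) _))
    where
    same-colour : colour (encode u) x ≡ colour (encode v) y
    same-colour = Fin.toℕ-injective (trans (sym (S-C u x)) (trans eq (S-C v y)))

theorem2 : (r : ℕ) → 1 ≤ r → (m : Fin r → ℕ) → (∀ i → 2 ≤ m i) →
    (k : ℕ) → 1 ≤ k → ChkLeBound r m k
theorem2 r 1≤r m 2≤m k 1≤k with floor-log₂ 1≤r (r≤total r m (λ i → ≤-trans (s≤s z≤n) (2≤m i)))
... | ℓ , 2^ℓ*r≤M , M≤2^[1+ℓ]*r =
  r * (k + ℓ) * 48 , leBound k ℓ 2^ℓ*r≤M ,
  choosable (≤-trans 1≤k (m≤m+n k ℓ)) (m≤m+n k ℓ)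
            -- K = k + ℓ reaches ℓ + 1 because k ≥ 1.
            (≤-trans M≤2^[1+ℓ]*r (*-monoˡ-≤ r (^-monoʳ-≤ 2 (+-monoˡ-≤ ℓ 1≤k))))
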